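{- Let $A=(a_{pq})$ be an $m\times m$ coloring matrix. Suppose $I,J\subseteq\{1,\dots,m\}$ are disjoint sets with $|I|=|J|$ such that $\sum_{i\in I}t_A^{(i)}(n)=\sum_{j\in J}t_A^{(j)}(n)$ for all $n$, and that $\ell\in\{1,\dots,m\}$ is a color (possibly in $I$ or $J$) with $a_{\ell i}=0$ for all $i\in I$ and $a_{\ell j}=1$ for all $j\in J$. Let $B=(b_{pq})$ be the $m\times m$ coloring matrix defined by $b_{pq}=1$ if $p=\ell$ and $q\in I$, $b_{pq}=0$ if $p=\ell$ and $q\in J$, and $b_{pq}=a_{pq}$ otherwise. Then $A$ and $B$ are strictly tree coloring equivalent. Furthermore, for all $n\ge1$, $$\sum_{i\in I}t^{(i)}_A(n)=\sum_{j\in J}t^{(j)}_A(n)=\sum_{i\in I}t^{(i)}_{B}(n)=\sum_{j\in J}t^{(j)}_{B}(n).$$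
   Context: A plane tree is an unlabeled rooted tree in which the children of every vertex are linearly ordered. A coloring matrix is an $m\times m$ matrix $A=(a_{ij})$ with entries in $\{0,1\}$. An $A$-coloring of a plane tree assigns to each vertex a color in $\{1,\dots,m\}$ such that whenever a vertex of color $j$ is a child of a vertex of color $i$, $a_{ij}=1$. Let $t_A^{(i)}(n)$ be the number of pairs (plane tree with $n$ vertices, $A$-coloring of it) in which the root has color $i$. Two $m\times m$ coloring matrices $A,B$ are strictly tree coloring equivalent if $t_A^{(i)}(n)=t_B^{(i)}(n)$ for all $n\ge1$ and all $1\le i\le m$. -}

module Defs where

open import Data.Bool.Base using (if_then_else_)
open import Data.Empty using (⊥; ⊥-elim)
open import Data.Fin.Base using (Fin; zero; suc)
open import Data.Fin.Patterns using (0F; 1F)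
open import Data.Fin.Properties using (_≟_; 0↔⊥; 1↔⊤; +↔⊎; *↔×)
open import Data.Fin.Subset using (Subset)
open import Data.Fin.Subset.Properties using (_∈?_)
open import Data.List.Base using (List; []; _∷_; map; filter; allFin)
open import Data.List.Relation.Unary.All using (All; []; _∷_)
open import Data.Nat.Base using (ℕ; zero; suc; _+_; _*_; _≤_; s≤s)
open import Data.Nat.ListAction using (sum)
open import Data.Nat.Properties using (≤-refl; ≤-trans; m≤m+n; m≤n+m)
open import Data.Product.Base using (Σ; Σ-syntax; _×_; _,_; proj₁)
open import Data.Product.Function.NonDependent.Propositional using (_×-↔_)
open import Data.Sum.Base using (_⊎_; inj₁; inj₂)
open import Data.Sum.Function.Propositional using (_⊎-↔_)
open import Data.Unit.Base using (⊤; tt)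
open import Function.Bundles using (_↔_; mk↔ₛ′)
open import Function.Properties.Inverse using (↔-sym; ↔-trans)
open import Relation.Binary.PropositionalEquality using (_≡_; refl)
open import Relation.Nullary.Decidable using (yes; no; does; _×-dec_)

data PlaneTree : Set where
  node : List PlaneTree → PlaneTree

mutual
  size : PlaneTree → ℕ
  size (node τs) = suc (sizes τs)

  sizes : List PlaneTree → ℕ
  sizes []       = 0
  sizes (τ ∷ τs) = size τ + sizes τs

ColoringMatrix : ℕ → Set
ColoringMatrix m = Fin m → Fin m → Fin 2

-- An arbitrary assignment of one of m colors to every vertex of a tree. It is
-- first-order data rather than a function on vertices, so that _≡_ on
-- assignments is the intended equality without function extensionality.
data Assignment (m : ℕ) : PlaneTree → Set where
  node : ∀ {τs} → Fin m → All (Assignment m) τs → Assignment m (node τs)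

rootColor : ∀ {m τ} → Assignment m τ → Fin m
rootColor (node i _) = i

-- IsColoringBelow A i κs: the subtrees colored by κs may be hung below a
-- parent of color i.
mutual
  IsColoring : ∀ {m τ} → ColoringMatrix m → Assignment m τ → Set
  IsColoring A (node i κs) = IsColoringBelow A i κs

  IsColoringBelow : ∀ {m τs} → ColoringMatrix m → Fin m →
                    All (Assignment m) τs → Set
  IsColoringBelow A i []       = ⊤
  IsColoringBelow A i (κ ∷ κs) =
    A i (rootColor κ) ≡ 1F × IsColoring A κ × IsColoringBelow A i κs

ColoredTree : ∀ {m} → ColoringMatrix m → Fin m → ℕ → Set
ColoredTree {m} A i n =
  Σ[ τ ∈ PlaneTree ] size τ ≡ n ×
  Σ[ κ ∈ Assignment m τ ] IsColoring A κ × rootColor κ ≡ i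

Finite : Set → Set
Finite X = Σ[ k ∈ ℕ ] X ↔ Fin k

finite-↔ : ∀ {X Y} → X ↔ Y → Finite Y → Finite X
finite-↔ f (k , g) = k , ↔-trans f g

finite-⊥ : Finite ⊥
finite-⊥ = 0 , ↔-sym 0↔⊥

finite-⊤ : Finite ⊤
finite-⊤ = 1 , ↔-sym 1↔⊤

finite-⊎ : ∀ {X Y} → Finite X → Finite Y → Finite (X ⊎ Y)
finite-⊎ (k , f) (l , g) = k + l , ↔-trans (f ⊎-↔ g) (↔-sym +↔⊎)

finite-× : ∀ {X Y} → Finite X → Finite Y → Finite (X × Y)
finite-× (k , f) (l , g) = k * l , ↔-trans (f ×-↔ g) (↔-sym *↔×)

finite-≡ : ∀ {n} (x y : Fin n) → Finite (x ≡ y)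
finite-≡ x y with x ≟ y
... | yes refl = finite-↔ (mk↔ₛ′ (λ _ → tt) (λ _ → refl) (λ _ → refl) λ { refl → refl }) finite-⊤
... | no x≢y   = finite-↔ (mk↔ₛ′ x≢y (λ ()) (λ ()) λ { refl → ⊥-elim (x≢y refl) }) finite-⊥

finite-ΣFin : ∀ m {P : Fin m → Set} → (∀ i → Finite (P i)) → Finite (Σ (Fin m) P)
finite-ΣFin zero    f = finite-↔ (mk↔ₛ′ (λ { (() , _) }) (λ ()) (λ ()) λ { (() , _) }) finite-⊥
finite-ΣFin (suc m) f =
  finite-↔ (mk↔ₛ′ (λ { (zero , p) → inj₁ p ; (suc i , p) → inj₂ (i , p) })
                  (λ { (inj₁ p) → zero , p ; (inj₂ (i , p)) → suc i , p })
                  (λ { (inj₁ p) → refl ; (inj₂ (i , p)) → refl })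
                  (λ { (zero , p) → refl ; (suc i , p) → refl }))
           (finite-⊎ (f zero) (finite-ΣFin m (λ i → f (suc i))))

Split : (ℕ → ℕ → Set) → ℕ → Set
Split P n = Σ[ a ∈ ℕ ] Σ[ b ∈ ℕ ] a + b ≡ n × P a b

finite-Split : ∀ {P : ℕ → ℕ → Set} n → (∀ a b → a + b ≡ n → Finite (P a b)) → Finite (Split P n)
finite-Split zero f =
  finite-↔ (mk↔ₛ′ (λ { (zero , zero , refl , p) → p })
                  (λ p → zero , zero , refl , p)
                  (λ _ → refl)
                  (λ { (zero , zero , refl , p) → refl }))
           (f zero zero refl)
finite-Split {P} (suc n) f =
  finite-↔ (mk↔ₛ′ (λ { (zero , b , refl , p) → inj₁ p
                     ; (suc a , b , refl , p) → inj₂ (a , b , refl , p) })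
                  (λ { (inj₁ p) → zero , suc n , refl , p
                     ; (inj₂ (a , b , refl , p)) → suc a , b , refl , p })
                  (λ { (inj₁ p) → refl ; (inj₂ (a , b , refl , p)) → refl })
                  (λ { (zero , b , refl , p) → refl ; (suc a , b , refl , p) → refl }))
           (finite-⊎ (f zero (suc n) refl)
                     (finite-Split {λ a b → P (suc a) b} n λ { a b refl → f (suc a) b refl }))

Forest : ∀ {m} → ColoringMatrix m → Fin m → ℕ → Set
Forest {m} A i n =
  Σ[ τs ∈ List PlaneTree ] sizes τs ≡ n ×
  Σ[ κs ∈ All (Assignment m) τs ] IsColoringBelow A i κs

forest-0 : ∀ {m} (A : ColoringMatrix m) i → Forest A i 0 ↔ ⊤
forest-0 A i =
  mk↔ₛ′ (λ _ → tt) (λ _ → [] , refl , [] , tt) (λ _ → refl)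
        (λ { ([] , refl , [] , tt) → refl ; (node _ ∷ _ , () , _) })

forest-suc : ∀ {m} (A : ColoringMatrix m) i n →
  Forest A i (suc n) ↔
  Split (λ a b → Σ[ j ∈ Fin m ] A i j ≡ 1F × Forest A j a × Forest A i b) n
forest-suc A i n =
  mk↔ₛ′ (λ { ([] , () , _)
           ; (node σs ∷ τs , refl , node j κs ∷ λs , p , q , r) →
             sizes σs , sizes τs , refl , j , p , (σs , refl , κs , q) , (τs , refl , λs , r) })
        (λ { (_ , _ , refl , j , p , (σs , refl , κs , q) , (τs , refl , λs , r)) →
             node σs ∷ τs , refl , node j κs ∷ λs , p , q , r })
        (λ { (_ , _ , refl , j , p , (σs , refl , κs , q) , (τs , refl , λs , r)) → refl })
        (λ { ([] , () , _)
           ; (node σs ∷ τs , refl , node j κs ∷ λs , p , q , r) → refl })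

finite-Forest : ∀ {m} (A : ColoringMatrix m) N i n → n ≤ N → Finite (Forest A i n)
finite-Forest A N i zero _ = finite-↔ (forest-0 A i) finite-⊤
finite-Forest {m} A (suc N) i (suc n) (s≤s n≤N) =
  finite-↔ (forest-suc A i n)
    (finite-Split n λ { a b refl →
      finite-ΣFin m λ j →
        finite-× (finite-≡ (A i j) 1F)
          (finite-× (finite-Forest A N j a (≤-trans (m≤m+n a b) n≤N))
                    (finite-Forest A N i b (≤-trans (m≤n+m b a) n≤N))) })

coloredTree-finite : ∀ {m} (A : ColoringMatrix m) i n → Finite (ColoredTree A i n)
coloredTree-finite A i zero =
  finite-↔ (mk↔ₛ′ (λ { (node _ , () , _) }) (λ ()) (λ ()) (λ { (node _ , () , _) })) finite-⊥
coloredTree-finite A i (suc n) =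
  finite-↔ (mk↔ₛ′ (λ { (node τs , refl , node _ κs , p , refl) → τs , refl , κs , p })
                  (λ { (τs , refl , κs , p) → node τs , refl , node i κs , p , refl })
                  (λ { (τs , refl , κs , p) → refl })
                  (λ { (node τs , refl , node _ κs , p , refl) → refl }))
           (finite-Forest A n i n ≤-refl)

-- t A i n is t_A^{(i)}(n), the cardinality of ColoredTree A i n.
t : ∀ {m} → ColoringMatrix m → Fin m → ℕ → ℕ
t A i n = proj₁ (coloredTree-finite A i n)

StrictlyTreeColoringEquivalent : ∀ {m} → ColoringMatrix m → ColoringMatrix m → Set
StrictlyTreeColoringEquivalent A B = ∀ n → 1 ≤ n → ∀ i → t A i n ≡ t B i n

sumOver : ∀ {m} → Subset m → (Fin m → ℕ) → ℕ
sumOver {m} I f = sum (map f (filter (_∈? I) (allFin m)))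

exchange : ∀ {m} → ColoringMatrix m → Fin m → Subset m → Subset m → ColoringMatrix m
exchange A ℓ I J p q =
  if does (p ≟ ℓ ×-dec q ∈? I) then 1F else
  if does (p ≟ ℓ ×-dec q ∈? J) then 0F else
  A p q

{-# OPTIONS --safe #-}

-- Cutting the edge from the root to its first child gives
--   t⁽ⁱ⁾(n+2) = Σ_{a+b=n} Σ_j a_ij t⁽ʲ⁾(a+1) t⁽ⁱ⁾(b+1),
-- so row i of the matrix enters only through the sums Σ_j a_ij t⁽ʲ⁾(a+1).
-- Passing from A to B trades, in row ℓ, the sum over J for the equal sum over
-- I; strong induction on n then gives t_A = t_B.
module Submission where

open import Defs
open import Data.Bool.Base using (true; false; if_then_else_)
open import Data.Empty using (⊥-elim)
open import Data.Fin.Base using (Fin; zero; suc)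
open import Data.Fin.Patterns using (0F; 1F)
open import Data.Fin.Permutation using (↔⇒≡)
open import Data.Fin.Properties using (_≟_)
open import Data.Fin.Subset using (Subset; _∈_; _∩_; Empty; ∣_∣)
open import Data.Fin.Subset.Properties using (_∈?_; x∈p∩q⁺)
open import Data.List.Base using (List; []; _∷_; map; filter; allFin; tabulate)
open import Data.List.Properties using (map-cong; map-tabulate)
open import Data.Nat.Base using (ℕ; zero; suc; _+_; _*_; _≤_; _<_; s≤s; z≤n)
open import Data.Nat.Induction using (<-rec)
open import Data.Nat.ListAction using (sum)
open import Data.Nat.Properties using (+-identityʳ; +-cancelʳ-≡; *-assoc; *-distribʳ-+; +-commutativeSemigroup; m≤m+n; m≤n+m; ≤-refl)
open import Algebra.Properties.CommutativeSemigroup +-commutativeSemigroup using (interchange)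
open import Data.Product.Base using (_×_; _,_; proj₁)
open import Function.Base using (id; _∘_)
open import Function.Properties.Inverse using (↔-sym; ↔-trans)
open import Relation.Binary.PropositionalEquality using (_≡_; _≢_; refl; sym; trans; cong; cong₂; module ≡-Reasoning)
open import Relation.Nullary.Decidable using (Dec; yes; no; does)
open import Relation.Unary using (Pred; Decidable)

open ≡-Reasoning

private variable
  X : Set
  m : ℕ

card : Finite X → ℕ
card = proj₁

-- Needed because `finite-Forest` depends on a bound `N`: the same type of forests receives
-- different `Finite` witnesses under different bounds.
card-unique : (F G : Finite X) → card F ≡ card G
card-unique (_ , f) (_ , g) = ↔⇒≡ (↔-trans (↔-sym f) g)

-- The recursion copies that of `finite-Split`, so the cardinality of a split unfolds to it clause
-- by clause.
convolution : ℕ → (ℕ → ℕ → ℕ) → ℕ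
convolution zero    g = g 0 0
convolution (suc n) g = g 0 (suc n) + convolution n (g ∘ suc)

convolution-cong : ∀ n {g h : ℕ → ℕ → ℕ} →
  (∀ a b → a + b ≡ n → g a b ≡ h a b) → convolution n g ≡ convolution n h
convolution-cong zero    eq = eq 0 0 refl
convolution-cong (suc n) eq =
  cong₂ _+_ (eq 0 (suc n) refl) (convolution-cong n λ a b e → eq (suc a) b (cong suc e))

card-Split : ∀ {P : ℕ → ℕ → Set} n (F : ∀ a b → a + b ≡ n → Finite (P a b)) {g} →
  (∀ a b e → card (F a b e) ≡ g a b) → card (finite-Split n F) ≡ convolution n g
card-Split zero    F eq = eq 0 0 refl
card-Split (suc n) F eq =
  cong₂ _+_ (eq 0 (suc n) refl) (card-Split n _ λ { a b refl → eq (suc a) b refl })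

sum-map-+ : (f g : X → ℕ) (xs : List X) →
  sum (map (λ x → f x + g x) xs) ≡ sum (map f xs) + sum (map g xs)
sum-map-+ f g []       = refl
sum-map-+ f g (x ∷ xs) =
  trans (cong (f x + g x +_) (sum-map-+ f g xs)) (interchange (f x) (g x) _ _)

sum-map-*ʳ : (f : X → ℕ) (c : ℕ) (xs : List X) →
  sum (map (λ x → f x * c) xs) ≡ sum (map f xs) * c
sum-map-*ʳ f c []       = refl
sum-map-*ʳ f c (x ∷ xs) =
  trans (cong (f x * c +_) (sum-map-*ʳ f c xs)) (sym (*-distribʳ-+ c (f x) _))

sum-map-filter : ∀ {p} {P : Pred X p} (P? : Decidable P) (f : X → ℕ) (xs : List X) →
  sum (map f (filter P? xs)) ≡ sum (map (λ x → if does (P? x) then f x else 0) xs)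
sum-map-filter P? f []       = refl
sum-map-filter P? f (x ∷ xs) with does (P? x)
... | true  = cong (f x +_) (sum-map-filter P? f xs)
... | false = sum-map-filter P? f xs

sumFin : (Fin m → ℕ) → ℕ
sumFin {m} f = sum (map f (allFin m))

sumFin-cong : {f g : Fin m → ℕ} → (∀ j → f j ≡ g j) → sumFin f ≡ sumFin g
sumFin-cong {m} eq = cong sum (map-cong eq (allFin m))

sumOver-cong : (I : Subset m) {f g : Fin m → ℕ} →
  (∀ i → f i ≡ g i) → sumOver I f ≡ sumOver I g
sumOver-cong {m} I eq = cong sum (map-cong eq (filter (_∈? I) (allFin m)))

-- Turns a sum over a subset into a sum over all colors, which can be combined termwise with a row
-- sum.
restriction : Subset m → (Fin m → ℕ) → Fin m → ℕ
restriction I x j = if does (j ∈? I) then x j else 0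

card-ΣFin-tabulate : ∀ m {P : Fin m → Set} (F : ∀ i → Finite (P i)) →
  card (finite-ΣFin m F) ≡ sum (tabulate (card ∘ F))
card-ΣFin-tabulate zero    F = refl
card-ΣFin-tabulate (suc m) F = cong (card (F zero) +_) (card-ΣFin-tabulate m (F ∘ suc))

card-ΣFin : ∀ m {P : Fin m → Set} (F : ∀ i → Finite (P i)) →
  card (finite-ΣFin m F) ≡ sumFin (card ∘ F)
card-ΣFin m F =
  trans (card-ΣFin-tabulate m F) (cong sum (sym (map-tabulate id (card ∘ F))))

-- The matrix entry as a number, 0 or 1, in the form in which it occurs as a factor in the
-- cardinality of `finite-Forest`.
entry : Fin 2 → ℕ
entry x = card (finite-≡ x 1F)

rowSum : ColoringMatrix m → Fin m → (Fin m → ℕ) → ℕ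
rowSum A i x = sumFin λ j → entry (A i j) * x j

rowSum-congʳ : (A : ColoringMatrix m) (i : Fin m) {x y : Fin m → ℕ} →
  (∀ j → x j ≡ y j) → rowSum A i x ≡ rowSum A i y
rowSum-congʳ A i eq = sumFin-cong λ j → cong (entry (A i j) *_) (eq j)

-- The left side already unfolds to the cardinality of a `finite-Split`, since `finite-Forest` is
-- built by this very decomposition.
t-suc-suc : (A : ColoringMatrix m) (i : Fin m) (n : ℕ) →
  t A i (suc (suc n)) ≡
  convolution n λ a b → rowSum A i (λ j → t A j (suc a)) * t A i (suc b)
t-suc-suc {m} A i n = card-Split n _ λ { a b refl → begin
  _ ≡⟨ card-ΣFin m _ ⟩
  -- The unfolded forest counts carry the bound `n`, whereas `t A j (suc a)` and `t A i (suc b)`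
  -- carry the bounds `a` and `b`.
  _ ≡⟨ sumFin-cong (λ j → trans
         (cong (entry (A i j) *_)
           (cong₂ _*_ (card-unique (finite-Forest A n j a _) (finite-Forest A a j a ≤-refl))
                      (card-unique (finite-Forest A n i b _) (finite-Forest A b i b ≤-refl))))
         (sym (*-assoc (entry (A i j)) (t A j (suc a)) (t A i (suc b))))) ⟩
  _ ≡⟨ sum-map-*ʳ (λ j → entry (A i j) * t A j (suc a)) (t A i (suc b)) (allFin m) ⟩
  _ ∎ }

module _ (A : ColoringMatrix m) (I J : Subset m) (ℓ : Fin m)
         (I∩J≡∅ : Empty (I ∩ J))
         (A∣I≡0 : ∀ i → i ∈ I → A ℓ i ≡ 0F)
         (A∣J≡1 : ∀ j → j ∈ J → A ℓ j ≡ 1F) where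

  private
    B : ColoringMatrix m
    B = exchange A ℓ I J

  -- Both sides equal `x j` on `I` and on `J`, and elsewhere the entry is unchanged. Adding the two
  -- restrictions on opposite sides avoids subtraction in ℕ.
  exchange-entry : (x : Fin m → ℕ) (j : Fin m) →
    entry (A ℓ j) * x j + restriction I x j ≡
    entry (B ℓ j) * x j + restriction J x j
  -- `B ℓ j` does not reduce until this test is decided.
  exchange-entry x j with ℓ ≟ ℓ
  ... | no ℓ≢ℓ = ⊥-elim (ℓ≢ℓ refl)
  ... | yes _ with j ∈? I | j ∈? J
  ...   | yes j∈I | yes j∈J = ⊥-elim (I∩J≡∅ (j , x∈p∩q⁺ (j∈I , j∈J)))
  ...   | yes j∈I | no _    rewrite A∣I≡0 j j∈I = sym (trans (+-identityʳ _) (+-identityʳ _))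
  ...   | no _    | yes j∈J rewrite A∣J≡1 j j∈J = trans (+-identityʳ _) (+-identityʳ _)
  ...   | no _    | no _    = refl

  exchange-≢ : ∀ {p} → p ≢ ℓ → ∀ q → B p q ≡ A p q
  exchange-≢ {p} p≢ℓ q with p ≟ ℓ
  ... | yes p≡ℓ = ⊥-elim (p≢ℓ p≡ℓ)
  ... | no _    = refl

  -- Rows other than `ℓ` are untouched. In row `ℓ`, summing `exchange-entry` over all colors leaves
  -- equal sums over `I` and `J` to cancel.
  rowSum-exchange : (x : Fin m → ℕ) → sumOver I x ≡ sumOver J x →
    ∀ i → rowSum A i x ≡ rowSum B i x
  rowSum-exchange x ΣI≡ΣJ i = byRow (i ≟ ℓ)
    where
    rowSum+sumOver : (C : ColoringMatrix m) (K : Subset m) →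
      rowSum C ℓ x + sumOver K x ≡ sumFin (λ j → entry (C ℓ j) * x j + restriction K x j)
    rowSum+sumOver C K =
      trans (cong (rowSum C ℓ x +_) (sum-map-filter (_∈? K) x (allFin m)))
            (sym (sum-map-+ (λ j → entry (C ℓ j) * x j) (restriction K x) (allFin m)))

    byRow : Dec (i ≡ ℓ) → rowSum A i x ≡ rowSum B i x
    byRow (no i≢ℓ)   = sumFin-cong λ j → cong (λ e → entry e * x j) (sym (exchange-≢ i≢ℓ j))
    byRow (yes refl) = +-cancelʳ-≡ (sumOver J x) _ _ (begin
      rowSum A ℓ x + sumOver J x                              ≡⟨ cong (rowSum A ℓ x +_) ΣI≡ΣJ ⟨
      rowSum A ℓ x + sumOver I x                              ≡⟨ rowSum+sumOver A I ⟩
      sumFin (λ j → entry (A ℓ j) * x j + restriction I x j)  ≡⟨ sumFin-cong (exchange-entry x) ⟩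
      sumFin (λ j → entry (B ℓ j) * x j + restriction J x j)  ≡⟨ rowSum+sumOver B J ⟨
      rowSum B ℓ x + sumOver J x                              ∎)

  t-exchange : (∀ n → 1 ≤ n → sumOver I (λ i → t A i n) ≡ sumOver J (λ j → t A j n)) →
    ∀ n i → t A i (suc n) ≡ t B i (suc n)
  t-exchange ΣI≡ΣJ = <-rec _ step
    where
    step : ∀ n → (∀ {k} → k < n → ∀ i → t A i (suc k) ≡ t B i (suc k)) →
      ∀ i → t A i (suc n) ≡ t B i (suc n)
    -- A single vertex: both counts compute to 1.
    step zero    ih i = refl
    step (suc n) ih i = begin
      t A i (suc (suc n))  ≡⟨ t-suc-suc A i n ⟩
      _                    ≡⟨ convolution-cong n (λ { a b refl → cong₂ _*_
        -- The matrix is exchanged first, while the weights are still the counts for `A`, whose sums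
        -- over `I` and `J` agree by hypothesis. Only then does induction replace the weights by
        -- those for `B`; `a` and `b` are at most `n`, hence below `suc n`.
        (trans (rowSum-exchange (λ j → t A j (suc a)) (ΣI≡ΣJ (suc a) (s≤s z≤n)) i)
               (rowSum-congʳ B i (ih (s≤s (m≤m+n a b)))))
        (ih (s≤s (m≤n+m b a)) i) }) ⟩
      _                    ≡⟨ t-suc-suc B i n ⟨
      t B i (suc (suc n))  ∎

theorem15 : ∀ (m : ℕ) (A : ColoringMatrix m) (I J : Subset m) (ℓ : Fin m) →
    Empty (I ∩ J) →
    ∣ I ∣ ≡ ∣ J ∣ →
    (∀ n → 1 ≤ n → sumOver I (λ i → t A i n) ≡ sumOver J (λ j → t A j n)) →
    (∀ i → i ∈ I → A ℓ i ≡ 0F) →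
    (∀ j → j ∈ J → A ℓ j ≡ 1F) →
    let B = exchange A ℓ I J in
    StrictlyTreeColoringEquivalent A B ×
    (∀ n → 1 ≤ n →
    sumOver I (λ i → t A i n) ≡ sumOver J (λ j → t A j n) ×
    sumOver J (λ j → t A j n) ≡ sumOver I (λ i → t B i n) ×
    sumOver I (λ i → t B i n) ≡ sumOver J (λ j → t B j n))
theorem15 m A I J ℓ I∩J≡∅ _ ΣI≡ΣJ A∣I≡0 A∣J≡1 = A~B , λ n 1≤n →
    ΣI≡ΣJ n 1≤n ,
    trans (sym (ΣI≡ΣJ n 1≤n)) (sumOver-cong I (A~B n 1≤n)) ,
    trans (sym (sumOver-cong I (A~B n 1≤n)))
          (trans (ΣI≡ΣJ n 1≤n) (sumOver-cong J (A~B n 1≤n)))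
  where
  A~B : StrictlyTreeColoringEquivalent A (exchange A ℓ I J)
  A~B (suc n) _ = t-exchange A I J ℓ I∩J≡∅ A∣I≡0 A∣J≡1 ΣI≡ΣJ n
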